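{- (1) For all integers $a,k$ with $2\le a\le k-2$, $\mathrm{ex}_c(n,B(k,a))\ge \max\left\{\left\lfloor \frac{(k-a)n}{2}\right\rfloor,\ \left\lfloor \frac{a-1}{2}\right\rfloor\left(n-\left\lfloor \frac{a-1}{2}\right\rfloor\right)\right\}$. (2) For all integers $a,k$ with $2\le a\le k/3$, $\mathrm{ex}_c(n,B(k,a))=\lfloor \frac{(k-a)n}{2}\rfloor$ for all sufficiently large $n$.
   Context: $\mathrm{ex}_c(n,F)$ denotes the largest number of edges in a connected $n$-vertex graph containing no subgraph isomorphic to $F$. The broom $B(k,a)$ is the tree on $k$ vertices obtained from a path with $a-1$ edges and $k-a$ further edges by identifying one endpoint of each of them at a common vertex (the center); i.e. the spider $S_{a-1,1,\dots,1}$ with one leg of $a-1$ edges and $k-a$ legs of one edge.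
   Formalization: Part (1) is stated for n ≥ k−a+1; for 1 ≤ n ≤ k−a it is false, since every graph on n vertices is then B(k,a)-free and ex_c(n,B(k,a)) = n(n−1)/2 < ⌊(k−a)n/2⌋ (e.g. a=2, k=4, n=2). -}

module Defs where

open import Data.Nat using (ℕ; zero; suc; _+_; _*_; _∸_; _≤_; _<_; ⌊_/2⌋; _<ᵇ_; _≡ᵇ_)
open import Data.Nat.Base using (_⊔_)
open import Data.Bool using (Bool; true; false; _∧_; _∨_; if_then_else_; not)
open import Data.Fin using (Fin; toℕ)
open import Data.List using (List; map; allFin)
open import Data.Nat.ListAction using (sum)
open import Data.Product using (Σ; _×_; ∃)
open import Function.Definitions using (Injective)
open import Relation.Binary.PropositionalEquality using (_≡_)
open import Relation.Nullary using (¬_)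

Graph : ℕ → Set
Graph n = Fin n → Fin n → Bool

IsSimple : ∀ {n} → Graph n → Set
IsSimple {n} G = (∀ (u v : Fin n) → G u v ≡ G v u) × (∀ (u : Fin n) → G u u ≡ false)

edgeCount : ∀ {n} → Graph n → ℕ
edgeCount {n} G =
  sum (map (λ u → sum (map (λ v → if (toℕ u <ᵇ toℕ v) ∧ G u v then 1 else 0) (allFin n))) (allFin n))

data Walk {n} (G : Graph n) : Fin n → Fin n → Set where
  here : ∀ {u} → Walk G u u
  step : ∀ {u v w} → G u v ≡ true → Walk G v w → Walk G u w

Connected : ∀ {n} → Graph n → Set
Connected {n} G = ∀ (u v : Fin n) → Walk G u v

Contains : ∀ {n k} → Graph n → Graph k → Set
Contains {n} {k} G F =
  Σ (Fin k → Fin n) λ f → Injective _≡_ _≡_ f × (∀ (u v : Fin k) → F u v ≡ true → G (f u) (f v) ≡ true)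

IsExc : ∀ {k} → ℕ → Graph k → ℕ → Set
IsExc n F m =
  (Σ (Graph n) λ G → IsSimple G × Connected G × ¬ Contains G F × edgeCount G ≡ m)
  × (∀ (G : Graph n) → IsSimple G → Connected G → ¬ Contains G F → edgeCount G ≤ m)

-- The broom B(k,a) on vertex set {0,…,k-1}: path 0-1-…-(a-1) (a-1 edges),
-- center 0, and k-a further edges from 0 to each of a,…,k-1.
broom : (k a : ℕ) → Graph k
broom k a u v = pathEdge ∨ leafEdge
  where
  i = toℕ u
  j = toℕ v
  pathEdge = (i <ᵇ a) ∧ (j <ᵇ a) ∧ ((suc i ≡ᵇ j) ∨ (suc j ≡ᵇ i))
  leafEdge = ((i ≡ᵇ 0) ∧ not (j <ᵇ a)) ∨ ((j ≡ᵇ 0) ∧ not (i <ᵇ a))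

{-# OPTIONS --safe #-}
-- Write d = k − a. A broom centred at u needs degree d + 1 at u, so graphs of maximum degree at most d
-- are free of it; a circulant plus a matching is such a graph with ⌊dn/2⌋ edges. The broom also
-- contains s + 1 disjoint edges for s = ⌊(a − 1)/2⌋, so K_{s,n−s}, covered by s vertices, is free of it too.
--
-- Conversely let 3a ≤ k, let n be large, and suppose a connected graph has more than dn/2 edges. If some
-- vertex w has degree at least k − 1, any path on a vertices starting at w leaves d neighbours of w
-- unused. Such a path exists: since d ≥ 2(a − 1), deleting vertices of small degree leaves a subgraph of
-- minimum degree at least a; walk from w to it by a shortest path and continue greedily inside.
-- Otherwise all degrees are below k − 1, so some vertex is at distance at least a − 1 from a vertex v
-- of degree at least d + 1, and a shortest path towards it uses only one neighbour of v.
module Submission where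

open import Defs
open import Data.Nat using (ℕ; _+_; _*_; _∸_; _≤_; _<_; _⊔_; ⌊_/2⌋)
open import Data.Product using (_×_; ∃)

open import Data.Bool using (Bool; true; false; _∧_; _∨_; if_then_else_; not)
open import Data.Bool.Properties using (T-≡; ∧-zeroʳ; ∧-identityʳ) renaming (_≟_ to _≟ᵇ_)
open import Data.Fin using (Fin; zero; suc; toℕ; fromℕ<; inject₁) renaming (_≟_ to _≟ᶠ_)
open import Data.Fin.Induction using (<-weakInduction)
open import Data.Fin.Properties
  using (toℕ<n; toℕ-fromℕ<; fromℕ<-injective; toℕ-injective; toℕ-inject₁; injective⇒≤; suc-injective; any?)
open import Data.List using (List; []; _∷_; _++_; length; filter; lookup; allFin; tabulate; concatMap; map)
open import Data.List.Membership.Propositional using (_∈_; _∉_; find; lose)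
open import Data.List.Membership.Propositional.Properties
  using (∈-allFin; ∈-lookup; ∈-filter⁺; ∈-filter⁻; ∈-++⁺ˡ; ∈-++⁺ʳ; ∈-tabulate⁻; ∈-concatMap⁺)
open import Data.List.Properties using (length-++; map-tabulate; length-tabulate)
open import Data.List.Relation.Binary.Subset.Propositional using (_⊆_)
open import Data.List.Relation.Unary.All as All using (All; []; _∷_)
open import Data.List.Relation.Unary.AllPairs using ([]; _∷_)
open import Data.List.Relation.Unary.Any as Any using (Any; here; there; index)
open import Data.List.Relation.Unary.Any.Properties using (lookup-index)
open import Data.List.Relation.Unary.Linked using (Linked; [-]; _∷_)
open import Data.List.Relation.Unary.Unique.Propositional using (Unique)
open import Data.List.Relation.Unary.Unique.Propositional.Properties using (allFin⁺; filter⁺; tabulate⁺)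
open import Data.Nat
  using (zero; suc; _^_; _≡ᵇ_; _<ᵇ_; z≤n; s≤s; z<s; s≤s⁻¹; s<s⁻¹; _≤?_; _<?_; _≟_; ∣_-_∣; ⌈_/2⌉)
import Data.Nat.ListAction as ListAction
open import Data.Nat.Properties hiding (_≟_; _≤?_; _<?_; suc-injective)
open import Data.Nat.Solver using (module +-*-Solver)
open import Data.Product using (Σ; _,_; proj₁; proj₂)
open import Data.Sum using (_⊎_; inj₁; inj₂; [_,_]′)
open import Data.Unit using (⊤; tt)
open import Function using (_∘_; id; case_of_)
open import Function.Bundles using (Equivalence; mk⇔)
open import Function.Definitions using (Injective)
open import Relation.Binary using (tri<; tri≈; tri>) renaming (Decidable to Decidable₂)
open import Relation.Binary.PropositionalEquality
  using (_≡_; _≢_; refl; sym; trans; cong; cong₂; subst; ≢-sym; module ≡-Reasoning)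
open import Relation.Nullary using (¬_; Dec; yes; no; does; contradiction; ¬?; _×-dec_; _⊎-dec_)
open import Relation.Nullary.Decidable using (dec-true; dec-false; does-⇔; decidable-stable)
open import Relation.Unary using (Decidable)
open import Algebra.Properties.CommutativeMonoid.Sum +-0-commutativeMonoid
  using (sum; sum-cong-≗; ∑-distrib-+; ∑-comm; sum-replicate-zero)

-- Lists without repetition

lookup-injective : ∀ {A : Set} {xs : List A} → Unique xs → ∀ i j → lookup xs i ≡ lookup xs j → i ≡ j
lookup-injective (_   ∷ _) zero    zero    _  = refl
lookup-injective (x∉ ∷ _) zero    (suc j) eq = contradiction eq (All.lookup x∉ (∈-lookup j))
lookup-injective (x∉ ∷ _) (suc i) zero    eq = contradiction (sym eq) (All.lookup x∉ (∈-lookup i))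
lookup-injective (_   ∷ u) (suc i) (suc j) eq = cong suc (lookup-injective u i j eq)

-- Sending each position of `xs` to the position where its entry occurs in `ys` is injective: the
-- target determines the entry, and the entry its position in `xs`.
unique-⊆⇒length≤ : ∀ {A : Set} {xs ys : List A} → Unique xs → xs ⊆ ys → length xs ≤ length ys
unique-⊆⇒length≤ {xs = xs} {ys} u sub = injective⇒≤ {f = pos} pos-injective
  where
  pos : Fin (length xs) → Fin (length ys)
  pos i = index (sub (∈-lookup i))
  pos-injective : Injective _≡_ _≡_ pos
  pos-injective {i} {j} eq = lookup-injective u i j
    (trans (lookup-index (sub (∈-lookup i)))
      (trans (cong (lookup ys) eq) (sym (lookup-index (sub (∈-lookup j))))))

module _ {n : ℕ} where
  open import Data.List.Membership.DecPropositional (_≟ᶠ_ {n}) public using (_∈?_)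

remove : ∀ {n} → List (Fin n) → List (Fin n) → List (Fin n)
remove ys = filter (λ x → ¬? (x ∈? ys))

length≤remove+length : ∀ {n} {xs : List (Fin n)} ys → Unique xs →
  length xs ≤ length (remove ys xs) + length ys
length≤remove+length {xs = xs} ys u =
  ≤-trans (unique-⊆⇒length≤ u sub) (≤-reflexive (length-++ (remove ys xs)))
  where
  sub : xs ⊆ remove ys xs ++ ys
  sub {x} x∈xs with x ∈? ys
  ... | yes x∈ys = ∈-++⁺ʳ (remove ys xs) x∈ys
  ... | no  x∉ys = ∈-++⁺ˡ (∈-filter⁺ (λ x → ¬? (x ∈? ys)) x∈xs x∉ys)

-- Pigeonhole, used both for the greedy step of a path and for finding a vertex outside a ball.
∃-fresh : ∀ {n} {xs ys : List (Fin n)} → Unique xs → length ys < length xs → ∃ λ x → x ∈ xs × x ∉ ys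
∃-fresh {xs = xs} {ys} u lt with remove ys xs in eq
... | []     = contradiction (subst (λ zs → length xs ≤ length zs + length ys) eq (length≤remove+length ys u)) (<⇒≱ lt)
... | x ∷ _ = x , ∈-filter⁻ (λ x → ¬? (x ∈? ys)) {xs = xs} (subst (x ∈_) (sym eq) (here refl))

-- Total, with a default value, so that the embedding of a broom can be defined from the index
-- alone; bounds enter only in the proofs about it.
nth : ∀ {A : Set} → A → List A → ℕ → A
nth d []       _       = d
nth d (x ∷ _)  zero    = x
nth d (_ ∷ xs) (suc i) = nth d xs i

nth-∈ : ∀ {A : Set} {d : A} xs {i} → i < length xs → nth d xs i ∈ xs
nth-∈ (_ ∷ _)  {zero}  _   = here refl
nth-∈ (_ ∷ xs) {suc i} i<l = there (nth-∈ xs (s<s⁻¹ i<l))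

nth-injective : ∀ {A : Set} {d : A} {xs} → Unique xs → ∀ {i j} → i < length xs → j < length xs →
  nth d xs i ≡ nth d xs j → i ≡ j
nth-injective (_ ∷ _) {zero} {zero} _ _ _ = refl
nth-injective {xs = _ ∷ xs} (x∉ ∷ _) {zero}  {suc j} _ j< eq = contradiction eq (All.lookup x∉ (nth-∈ xs (s<s⁻¹ j<)))
nth-injective {xs = _ ∷ xs} (x∉ ∷ _) {suc i} {zero}  i< _ eq = contradiction (sym eq) (All.lookup x∉ (nth-∈ xs (s<s⁻¹ i<)))
nth-injective (_ ∷ u) {suc i} {suc j} i< j< eq = cong suc (nth-injective u (s<s⁻¹ i<) (s<s⁻¹ j<) eq)

nth-linked : ∀ {A : Set} {R : A → A → Set} {d : A} {xs} → Linked R xs → ∀ {i} → suc i < length xs →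
  R (nth d xs i) (nth d xs (suc i))
nth-linked [-]     {_}     (s≤s ())
nth-linked (r ∷ _) {zero}  _ = r
nth-linked (_ ∷ l) {suc i} i< = nth-linked l (s<s⁻¹ i<)

-- Boolean tests

<ᵇ-true : ∀ {i j} → i < j → (i <ᵇ j) ≡ true
<ᵇ-true i<j = Equivalence.to T-≡ (<⇒<ᵇ i<j)

<ᵇ-true⁻ : ∀ {i j} → (i <ᵇ j) ≡ true → i < j
<ᵇ-true⁻ {i} {j} eq = <ᵇ⇒< i j (Equivalence.from T-≡ eq)

<ᵇ-false : ∀ {i j} → ¬ i < j → (i <ᵇ j) ≡ false
<ᵇ-false {i} {j} i≮j with i <ᵇ j in eq
... | false = refl
... | true  = contradiction (<ᵇ-true⁻ eq) i≮j

≡ᵇ-true : ∀ {i j} → i ≡ j → (i ≡ᵇ j) ≡ true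
≡ᵇ-true {i} {j} i≡j = Equivalence.to T-≡ (≡⇒≡ᵇ i j i≡j)

≡ᵇ-true⁻ : ∀ {i j} → (i ≡ᵇ j) ≡ true → i ≡ j
≡ᵇ-true⁻ {i} {j} eq = ≡ᵇ⇒≡ i j (Equivalence.from T-≡ eq)

∨-true⁻ : ∀ x {y} → x ∨ y ≡ true → x ≡ true ⊎ y ≡ true
∨-true⁻ true  _  = inj₁ refl
∨-true⁻ false eq = inj₂ eq

∧-true⁻ : ∀ x {y} → x ∧ y ≡ true → x ≡ true × y ≡ true
∧-true⁻ true eq = refl , eq

-- Finite sums

𝟙 : Bool → ℕ
𝟙 b = if b then 1 else 0

listSum≡sum : ∀ {n} (f : Fin n → ℕ) → ListAction.sum (map f (allFin n)) ≡ sum f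
listSum≡sum f = trans (cong ListAction.sum (map-tabulate id f)) (go f)
  where
  go : ∀ {n} (f : Fin n → ℕ) → ListAction.sum (tabulate f) ≡ sum f
  go {zero}  f = refl
  go {suc n} f = cong (f zero +_) (go (f ∘ suc))

sum-mono-≤ : ∀ {n} {f g : Fin n → ℕ} → (∀ i → f i ≤ g i) → sum f ≤ sum g
sum-mono-≤ {zero}  f≤g = z≤n
sum-mono-≤ {suc n} f≤g = +-mono-≤ (f≤g zero) (sum-mono-≤ (f≤g ∘ suc))

sum-const : ∀ n c → sum {n} (λ _ → c) ≡ n * c
sum-const zero    c = refl
sum-const (suc n) c = cong (c +_) (sum-const n c)

sum-zero : ∀ {n} {f : Fin n → ℕ} → (∀ i → f i ≡ 0) → sum f ≡ 0
sum-zero {n} f≡0 = trans (sum-cong-≗ f≡0) (sum-replicate-zero n)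

sum-single : ∀ {n} (f : Fin n → ℕ) w → (∀ v → v ≢ w → f v ≡ 0) → sum f ≡ f w
sum-single f zero    z = trans (cong (f zero +_) (sum-zero λ i → z (suc i) λ ())) (+-identityʳ _)
sum-single f (suc w) z = trans (cong (_+ sum (f ∘ suc)) (z zero λ ()))
  (sum-single (f ∘ suc) w λ v v≢w → z (suc v) (v≢w ∘ suc-injective))

sum-split : ∀ m {n} (f : ℕ → ℕ) → sum {m + n} (f ∘ toℕ) ≡ sum {m} (f ∘ toℕ) + sum {n} (λ i → f (m + toℕ i))
sum-split zero    f = refl
sum-split (suc m) f = trans (cong (f 0 +_) (sum-split m (f ∘ suc))) (sym (+-assoc (f 0) _ _))

sum-last : ∀ n (f : ℕ → ℕ) → sum {suc n} (f ∘ toℕ) ≡ sum {n} (f ∘ toℕ) + f n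
sum-last zero    f = +-comm (f 0) 0
sum-last (suc n) f = trans (cong (f 0 +_) (sum-last n (f ∘ suc))) (sym (+-assoc (f 0) _ _))

members : ∀ {n} → (Fin n → Bool) → List (Fin n)
members {n} P = filter (λ v → P v ≟ᵇ true) (allFin n)

members-unique : ∀ {n} (P : Fin n → Bool) → Unique (members P)
members-unique {n} P = filter⁺ (λ v → P v ≟ᵇ true) (allFin⁺ n)

∈-members⁺ : ∀ {n} (P : Fin n → Bool) {v} → P v ≡ true → v ∈ members P
∈-members⁺ P {v} = ∈-filter⁺ (λ v → P v ≟ᵇ true) (∈-allFin v)

∈-members⁻ : ∀ {n} (P : Fin n → Bool) {v} → v ∈ members P → P v ≡ true
∈-members⁻ {n} P v∈ = proj₂ (∈-filter⁻ (λ v → P v ≟ᵇ true) {xs = allFin n} v∈)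

length-members : ∀ {n} (P : Fin n → Bool) → length (members P) ≡ sum (𝟙 ∘ P)
length-members {n} P = trans (go (allFin n)) (listSum≡sum (𝟙 ∘ P))
  where
  go : ∀ xs → length (filter (λ v → P v ≟ᵇ true) xs) ≡ ListAction.sum (map (𝟙 ∘ P) xs)
  go []       = refl
  go (x ∷ xs) with P x
  ... | true  = cong suc (go xs)
  ... | false = go xs

-- Graphs

nbrs : ∀ {n} → Graph n → Fin n → List (Fin n)
nbrs G u = members (G u)

degree : ∀ {n} → Graph n → Fin n → ℕ
degree G u = length (nbrs G u)

edgeCount≡sum : ∀ {n} (G : Graph n) →
  edgeCount G ≡ sum (λ u → sum (λ v → 𝟙 ((toℕ u <ᵇ toℕ v) ∧ G u v)))
edgeCount≡sum {n} G = trans (listSum≡sum {n} (λ u → ListAction.sum (map (λ v → 𝟙 ((toℕ u <ᵇ toℕ v) ∧ G u v)) (allFin n))))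
  (sum-cong-≗ λ u → listSum≡sum (λ v → 𝟙 ((toℕ u <ᵇ toℕ v) ∧ G u v)))

-- `A` records an edge at its smaller end only, so an adjacency is `A u v + A v u`; exchanging the
-- order of summation makes the two halves equal.
handshake : ∀ {n} (G : Graph n) → IsSimple G → sum (λ u → sum (λ v → 𝟙 (G u v))) ≡ edgeCount G + edgeCount G
handshake {n} G (symm , loopless) = begin
  sum (λ u → sum (λ v → 𝟙 (G u v)))
    ≡⟨ sum-cong-≗ (λ u → sum-cong-≗ (pointwise u)) ⟩
  sum (λ u → sum (λ v → A u v + A v u))
    ≡⟨ sum-cong-≗ (λ u → ∑-distrib-+ (A u) (λ v → A v u)) ⟩
  sum (λ u → sum (A u) + sum (λ v → A v u))
    ≡⟨ ∑-distrib-+ (λ u → sum (A u)) (λ u → sum (λ v → A v u)) ⟩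
  sum (λ u → sum (A u)) + sum (λ u → sum (λ v → A v u))
    ≡⟨ cong (sum (λ u → sum (A u)) +_) (∑-comm (λ u v → A v u)) ⟩
  sum (λ u → sum (A u)) + sum (λ u → sum (A u))
    ≡⟨ sym (cong₂ _+_ (edgeCount≡sum G) (edgeCount≡sum G)) ⟩
  edgeCount G + edgeCount G ∎
  where
  open ≡-Reasoning
  A : Fin n → Fin n → ℕ
  A u v = 𝟙 ((toℕ u <ᵇ toℕ v) ∧ G u v)
  pointwise : ∀ u v → 𝟙 (G u v) ≡ A u v + A v u
  pointwise u v with <-cmp (toℕ u) (toℕ v)
  ... | tri< u<v _ v≮u rewrite <ᵇ-true u<v | <ᵇ-false v≮u = sym (+-identityʳ _)
  ... | tri> u≮v _ v<u rewrite <ᵇ-true v<u | <ᵇ-false u≮v = cong 𝟙 (symm u v)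
  ... | tri≈ u≮v u≡v v≮u rewrite <ᵇ-false u≮v | <ᵇ-false v≮u | toℕ-injective u≡v = cong 𝟙 (loopless v)

-- Brooms

broom⁻ : ∀ {k a} (u v : Fin k) → broom k a u v ≡ true →
  (toℕ u < a × toℕ v < a × (suc (toℕ u) ≡ toℕ v ⊎ suc (toℕ v) ≡ toℕ u))
  ⊎ (toℕ u ≡ 0 × a ≤ toℕ v) ⊎ (toℕ v ≡ 0 × a ≤ toℕ u)
broom⁻ {k} {a} u v e = [ inj₁ ∘ path , inj₂ ∘ leaf ]′ (∨-true⁻ ((i <ᵇ a) ∧ (j <ᵇ a) ∧ ((suc i ≡ᵇ j) ∨ (suc j ≡ᵇ i))) e)
  where
  i = toℕ u
  j = toℕ v
  path : (i <ᵇ a) ∧ (j <ᵇ a) ∧ ((suc i ≡ᵇ j) ∨ (suc j ≡ᵇ i)) ≡ true → i < a × j < a × (suc i ≡ j ⊎ suc j ≡ i)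
  path e with ∧-true⁻ (i <ᵇ a) e
  ... | i<a , e′ with ∧-true⁻ (j <ᵇ a) e′
  ... | j<a , e″ = <ᵇ-true⁻ i<a , <ᵇ-true⁻ j<a ,
    [ inj₁ ∘ ≡ᵇ-true⁻ , inj₂ ∘ ≡ᵇ-true⁻ {suc j} ]′ (∨-true⁻ (suc i ≡ᵇ j) e″)
  end : ∀ {i j} → (i ≡ᵇ 0) ∧ not (j <ᵇ a) ≡ true → i ≡ 0 × a ≤ j
  end {i} {j} e with ∧-true⁻ (i ≡ᵇ 0) e
  ... | i≡0 , j≮a = ≡ᵇ-true⁻ i≡0 , ≮⇒≥ λ j<a → case trans (sym (cong not (<ᵇ-true j<a))) j≮a of λ ()
  leaf : ((i ≡ᵇ 0) ∧ not (j <ᵇ a)) ∨ ((j ≡ᵇ 0) ∧ not (i <ᵇ a)) ≡ true → (i ≡ 0 × a ≤ j) ⊎ (j ≡ 0 × a ≤ i)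
  leaf e = [ inj₁ ∘ end , inj₂ ∘ end ]′ (∨-true⁻ ((i ≡ᵇ 0) ∧ not (j <ᵇ a)) e)

broom-path : ∀ {k a} (u v : Fin k) → suc (toℕ u) ≡ toℕ v → toℕ v < a → broom k a u v ≡ true
broom-path u v eq v<a
  rewrite <ᵇ-true (<-trans (≤-reflexive eq) v<a) | <ᵇ-true v<a | ≡ᵇ-true eq = refl

broom-leaf : ∀ {k a} (u v : Fin k) → toℕ u ≡ 0 → a ≤ toℕ v → broom k a u v ≡ true
broom-leaf {a = a} u v u≡0 a≤v rewrite <ᵇ-false (≤⇒≯ a≤v) | u≡0 | ∧-zeroʳ (0 <ᵇ a) = refl

module _ {n} (G : Graph n) where

  Adj : Fin n → Fin n → Set
  Adj u v = G u v ≡ true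

  -- Both cases of the upper bound end here: `v ∷ ys` becomes the path with `v` as center, and the
  -- entries of `ls` become the leaves.
  contains-broom : (∀ u v → G u v ≡ G v u) → ∀ {k a} v ys ls → suc (length ys) ≡ a →
    Linked Adj (v ∷ ys) → Unique (v ∷ ys) →
    Unique ls → (∀ {x} → x ∈ ls → Adj v x × x ∉ v ∷ ys) → k ∸ a ≤ length ls →
    Contains G (broom k a)
  contains-broom symm {k} {a} v ys ls refl linked path! ls! leaves k∸a≤ =
    f , f-injective , f-edge
    where
    -- The decision is an argument, so that the proofs below can match on it for two indices
    -- independently.
    g : (i : ℕ) → Dec (i < a) → Fin n
    g i (yes _) = nth v (v ∷ ys) i
    g i (no _)  = nth v ls (i ∸ a)

    f : Fin k → Fin n
    f u = g (toℕ u) (toℕ u <? a)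

    leaf< : ∀ {i} → ¬ i < a → i < k → i ∸ a < length ls
    leaf< i≮a i<k = <-≤-trans (∸-monoˡ-< i<k (≮⇒≥ i≮a)) k∸a≤

    g-injective : ∀ {i j} di dj → i < k → j < k → g i di ≡ g j dj → i ≡ j
    g-injective (yes i<a) (yes j<a) _ _ eq = nth-injective path! i<a j<a eq
    g-injective (no i≮a) (no j≮a) i<k j<k eq =
      ∸-cancelʳ-≡ (≮⇒≥ i≮a) (≮⇒≥ j≮a) (nth-injective ls! (leaf< i≮a i<k) (leaf< j≮a j<k) eq)
    g-injective (yes i<a) (no j≮a) _ j<k eq =
      contradiction (subst (_∈ v ∷ ys) eq (nth-∈ (v ∷ ys) i<a)) (proj₂ (leaves (nth-∈ ls (leaf< j≮a j<k))))
    g-injective (no i≮a) (yes j<a) i<k _ eq =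
      contradiction (subst (_∈ v ∷ ys) (sym eq) (nth-∈ (v ∷ ys) j<a)) (proj₂ (leaves (nth-∈ ls (leaf< i≮a i<k))))

    f-injective : Injective _≡_ _≡_ f
    f-injective {u} {w} eq = toℕ-injective (g-injective (toℕ u <? a) (toℕ w <? a) (toℕ<n u) (toℕ<n w) eq)

    g-path : ∀ {i} di dj → suc i < a → Adj (g i di) (g (suc i) dj)
    g-path (yes _) (yes _) si<a = nth-linked linked si<a
    g-path (no i≮a) _ si<a = contradiction (<-trans (n<1+n _) si<a) i≮a
    g-path _ (no si≮a) si<a = contradiction si<a si≮a

    g-leaf : ∀ {j} di dj → a ≤ j → j < k → Adj (g 0 di) (g j dj)
    g-leaf _ (yes j<a) a≤j _ = contradiction j<a (≤⇒≯ a≤j)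
    g-leaf (yes _) (no j≮a) _ j<k = proj₁ (leaves (nth-∈ ls (leaf< j≮a j<k)))
    g-leaf (no 0≮a) _ _ _ = contradiction z<s 0≮a

    g-edge : ∀ {i j} di dj → i < k → j < k →
      (i < a × j < a × (suc i ≡ j ⊎ suc j ≡ i)) ⊎ (i ≡ 0 × a ≤ j) ⊎ (j ≡ 0 × a ≤ i) → Adj (g i di) (g j dj)
    g-edge di dj _ _ (inj₁ (_ , j<a , inj₁ refl)) = g-path di dj j<a
    g-edge di dj _ _ (inj₁ (i<a , _ , inj₂ refl)) = trans (symm _ _) (g-path dj di i<a)
    g-edge di dj _ j<k (inj₂ (inj₁ (refl , a≤j))) = g-leaf di dj a≤j j<k
    g-edge di dj i<k _ (inj₂ (inj₂ (refl , a≤i))) = trans (symm _ _) (g-leaf dj di a≤i i<k)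

    f-edge : ∀ u w → broom k a u w ≡ true → Adj (f u) (f w)
    f-edge u w e = g-edge (toℕ u <? a) (toℕ w <? a) (toℕ<n u) (toℕ<n w) (broom⁻ u w e)

  -- The center is adjacent to vertex 1, which lies on the path because `2 ≤ a`, and to the leaves
  -- `a`, ..., `k − 1`; the function `e` lists these `k ∸ a + 1` vertices.
  degree-broom : ∀ {k a} → 2 ≤ a → a < k → Contains G (broom k a) → ∃ λ u → k ∸ a < degree G u
  degree-broom {k} {a} 2≤a a<k (f , f-inj , f-edge) =
    f center , subst (_≤ degree G (f center)) (length-tabulate h) (unique-⊆⇒length≤ (tabulate⁺ h-injective) h-adj)
    where
    at : ∀ {i} → .(i < k) → Fin k
    at i<k = fromℕ< i<k
    center : Fin k
    center = at (≤-<-trans z≤n a<k)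
    center≡0 : toℕ center ≡ 0
    center≡0 = toℕ-fromℕ< (≤-<-trans z≤n a<k)
    e : Fin (suc (k ∸ a)) → ℕ
    e zero    = 1
    e (suc j) = a + toℕ j
    e<k : ∀ i → e i < k
    e<k zero    = <-trans 2≤a a<k
    e<k (suc j) = <-≤-trans (+-monoʳ-< a (toℕ<n j)) (≤-reflexive (m+[n∸m]≡n (<⇒≤ a<k)))
    e-injective : ∀ {i j} → e i ≡ e j → i ≡ j
    e-injective {zero} {zero} _ = refl
    e-injective {zero} {suc j} eq = contradiction (≤-trans (m≤m+n a (toℕ j)) (≤-reflexive (sym eq))) (<⇒≱ 2≤a)
    e-injective {suc i} {zero} eq = contradiction (≤-trans (m≤m+n a (toℕ i)) (≤-reflexive eq)) (<⇒≱ 2≤a)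
    e-injective {suc i} {suc j} eq = cong suc (toℕ-injective (+-cancelˡ-≡ a _ _ eq))
    h : Fin (suc (k ∸ a)) → Fin n
    h i = f (at (e<k i))
    h-injective : ∀ {i j} → h i ≡ h j → i ≡ j
    h-injective {i} {j} eq = e-injective
      (trans (sym (toℕ-fromℕ< (e<k i))) (trans (cong toℕ (f-inj eq)) (toℕ-fromℕ< (e<k j))))
    edge : ∀ i → broom k a center (at (e<k i)) ≡ true
    edge zero = broom-path center (at (e<k zero)) (trans (cong suc center≡0) (sym (toℕ-fromℕ< (e<k zero))))
      (subst (_< a) (sym (toℕ-fromℕ< (e<k zero))) 2≤a)
    edge (suc j) = broom-leaf center (at (e<k (suc j))) center≡0
      (subst (a ≤_) (sym (toℕ-fromℕ< (e<k (suc j)))) (m≤m+n a (toℕ j)))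
    h-adj : tabulate h ⊆ nbrs G (f center)
    h-adj x∈ with ∈-tabulate⁻ {f = h} x∈
    ... | i , refl = ∈-members⁺ (G (f center)) (f-edge _ _ (edge i))

-- Growing paths

module _ {n} (G : Graph n) where

  module _ (St : ℕ → List (Fin n) → Fin n → Set)
    (next : ∀ j {avoid x} → St (suc j) avoid x →
      ∃ λ y → Adj G x y × y ∉ x ∷ avoid × St j (x ∷ avoid) y) where

    -- A state `St j avoid x` promises `j` further steps from `x` off `avoid`. One induction thus
    -- serves both the geodesic and the greedy paths.
    grow : ∀ j {avoid x} → St j avoid x → ∃ λ ys →
      length ys ≡ j × Linked (Adj G) (x ∷ ys) × Unique ys × All (_∉ x ∷ avoid) ys
    grow zero    _  = [] , refl , [-] , [] , []
    grow (suc j) st with next j st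
    ... | y , x~y , y∉ , st′ with grow j st′
    ... | ys , len , linked , ys! , fresh =
      y ∷ ys , cong suc len , x~y ∷ linked ,
      All.map (λ z∉ y≡z → z∉ (here (sym y≡z))) fresh ∷ ys! ,
      y∉ ∷ All.map (_∘ there) fresh

  module _ {T : Fin n → Set} (T? : Decidable T) where

    -- Distance to `T` at most `r`. Listing `x` beside its neighbours allows a step that stays put,
    -- which makes the predicate monotone in `r`.
    Near : ℕ → Fin n → Set
    Near zero    x = T x
    Near (suc r) x = Any (Near r) (x ∷ nbrs G x)

    near? : ∀ r → Decidable (Near r)
    near? zero    = T?
    near? (suc r) x = Any.any? (near? r) (x ∷ nbrs G x)

    near-step : ∀ r {x y} → Adj G x y → Near r y → Near (suc r) x
    near-step r x~y p = there (lose (∈-members⁺ (G _) x~y) p)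

    near-+ : ∀ t r {x} → Near r x → Near (t + r) x
    near-+ zero    r p = p
    near-+ (suc t) r p = here (near-+ t r p)

    near-≤ : ∀ r m {x} → r ≤ m → Near r x → Near m x
    near-≤ r m {x} r≤m p = subst (λ i → Near i x) (m∸n+n≡m r≤m) (near-+ (m ∸ r) r p)

    walk⇒near : ∀ {x z} → Walk G x z → T z → ∃ λ r → Near r x
    walk⇒near here         t = 0 , t
    walk⇒near (step x~y w) t with walk⇒near w t
    ... | r , p = suc r , near-step r x~y p

    -- Lower `r` as long as nearness persists. Where it first fails, the distance is `suc s`, and
    -- `¬ Near m x` forces the failure to come no lower than `m`.
    exact-distance : ∀ m r {x} → ¬ Near m x → Near r x → ∃ λ s → m ≤ s × Near (suc s) x × ¬ Near s x
    exact-distance m zero ¬m p = contradiction (near-≤ 0 m z≤n p) ¬m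
    exact-distance m (suc r) {x} ¬m p with near? r x | m ≤? r
    ... | yes q | _       = exact-distance m r ¬m q
    ... | no ¬q | yes m≤r = r , m≤r , p , ¬q
    ... | no _  | no m≰r  = contradiction (near-≤ (suc r) m (≰⇒> m≰r) p) ¬m

    -- The vertex `x` is at distance exactly `suc r` from `T`, and the avoided vertices are at
    -- distance more than `r`, so the next vertex of a shortest path is automatically new.
    Descending : ℕ → List (Fin n) → Fin n → Set
    Descending r avoid x = Near (suc r) x × ¬ Near r x × All (λ z → ¬ Near r z) avoid

    -- The neighbour `y` within `r` of `T` cannot be nearer than `r`, or `x` would be within `r`
    -- too. The new state is conditional on `r ≡ suc s` because for `r = 0` the set `T` has been
    -- reached.
    descend : ∀ r {avoid x} → Descending r avoid x →
      ∃ λ y → Adj G x y × y ∉ x ∷ avoid × Near r y × (∀ {s} → r ≡ suc s → Descending s (x ∷ avoid) y)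
    descend r (here p , ¬p , _) = contradiction p ¬p
    descend r {avoid} {x} (there p , ¬p , far) with find p
    ... | y , y∈ , q = y , x~y , (λ y∈′ → All.lookup (¬p ∷ far) y∈′ q) , q ,
      λ { {s} refl → q , (λ q′ → ¬p (near-step s x~y q′)) , All.map (_∘ here) (¬p ∷ far) }
      where
      x~y : Adj G x y
      x~y = ∈-members⁻ (G x) y∈

    -- Trivial at 0, because the last vertex may already lie in `T`, where no `Descending` state
    -- exists.
    Geodesic : ℕ → List (Fin n) → Fin n → Set
    Geodesic zero    avoid x = ⊤
    Geodesic (suc j) avoid x = ∃ λ r → j ≤ r × Descending r avoid x

    geodesic-tail : ∀ j r {avoid x} → j ≤ r → (∀ {s} → r ≡ suc s → Descending s avoid x) → Geodesic j avoid x
    geodesic-tail zero    _       _       _ = tt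
    geodesic-tail (suc j) (suc r) (s≤s j≤r) d = r , j≤r , d refl

    geodesic-next : ∀ j {avoid x} → Geodesic (suc j) avoid x →
      ∃ λ y → Adj G x y × y ∉ x ∷ avoid × Geodesic j (x ∷ avoid) y
    geodesic-next j (r , j≤r , d) with descend r d
    ... | y , x~y , y∉ , _ , d′ = y , x~y , y∉ , geodesic-tail j r j≤r d′

    -- Beyond `y` the path gets closer to `T` than any neighbour of `v` can be. All neighbours of
    -- `v` may therefore join the avoided list, which keeps them available as leaves, apart from
    -- `y`.
    geodesic-start : ∀ j {v} → Geodesic (suc j) [] v →
      ∃ λ y → Adj G v y × y ≢ v × Geodesic j (v ∷ nbrs G v) y
    geodesic-start j {v} (r , j≤r , d@(_ , ¬p , _)) with descend r d
    ... | y , v~y , y∉ , _ , d′ = y , v~y , (λ y≡v → y∉ (here y≡v)) , geodesic-tail j r j≤r widen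
      where
      widen : ∀ {s} → r ≡ suc s → Descending s (v ∷ nbrs G v) y
      widen {s} refl with d′ refl
      ... | q , ¬q , far ∷ _ = q , ¬q , far ∷ All.tabulate λ z∈ z-near → ¬p (near-step s (∈-members⁻ (G v) z∈) z-near)

    module _ {b} (inside : Fin n → List (Fin n)) (inside! : ∀ x → Unique (inside x))
      (inside-adj : ∀ {x y} → y ∈ inside x → Adj G x y × T y)
      (large : ∀ {x} → T x → b < length (inside x)) where

      -- First descend to T, then move greedily inside T.
      Greedy : ℕ → List (Fin n) → Fin n → Set
      Greedy j avoid x = length avoid + j ≤ b × (T x ⊎ ∃ λ r → Descending r avoid x)

      -- Inside `T`, the vertices visited so far, `x` included, number at most `b`, fewer than the
      -- neighbours that `inside x` offers; outside `T` the descent supplies a new vertex.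
      greedy-next : ∀ j {avoid x} → Greedy (suc j) avoid x →
        ∃ λ y → Adj G x y × y ∉ x ∷ avoid × Greedy j (x ∷ avoid) y
      greedy-next j {avoid} {x} (room , st) = go st
        where
        room′ : suc (length avoid) + j ≤ b
        room′ = ≤-trans (≤-reflexive (sym (+-suc (length avoid) j))) room
        go : T x ⊎ (∃ λ r → Descending r avoid x) → ∃ λ y → Adj G x y × y ∉ x ∷ avoid × Greedy j (x ∷ avoid) y
        go (inj₁ t) with ∃-fresh (inside! x) (≤-<-trans (≤-trans (m≤m+n _ j) room′) (large t))
        ... | y , y∈ , y∉ = y , proj₁ (inside-adj y∈) , y∉ , room′ , inj₁ (proj₂ (inside-adj y∈))
        go (inj₂ (r , d)) with descend r d
        go (inj₂ (zero  , d)) | y , x~y , y∉ , t , _  = y , x~y , y∉ , room′ , inj₁ t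
        go (inj₂ (suc s , d)) | y , x~y , y∉ , _ , d′ = y , x~y , y∉ , room′ , inj₂ (s , d′ refl)

      long-path : ∀ {z} → Connected G → T z → ∀ w → ∃ λ ys →
        length ys ≡ b × Linked (Adj G) (w ∷ ys) × Unique ys × All (_∉ w ∷ []) ys
      long-path {z} conn t w = grow Greedy greedy-next b (≤-refl , start)
        where
        start : T w ⊎ ∃ λ r → Descending r [] w
        start with T? w | walk⇒near (conn w z) t
        ... | yes t′ | _ = inj₁ t′
        ... | no ¬t  | r , p with exact-distance 0 r ¬t p
        ... | s , _ , p′ , ¬p = inj₂ (s , p′ , ¬p , [])

-- Dense subgraphs

module _ {n} (G : Graph n) (symm : ∀ u v → G u v ≡ G v u) where

  nbrsIn : (Fin n → Bool) → Fin n → List (Fin n)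
  nbrsIn S x = members (λ y → S y ∧ G x y)

  arcs : (Fin n → Bool) → ℕ
  arcs S = sum (λ u → sum (λ v → 𝟙 (S u ∧ S v ∧ G u v)))

  _is_ : Fin n → Fin n → Bool
  u is x = does (u ≟ᶠ x)

  delete : Fin n → (Fin n → Bool) → Fin n → Bool
  delete x S y = S y ∧ not (y is x)

  sum-is : ∀ x (f : Fin n → ℕ) → sum (λ u → if u is x then f u else 0) ≡ f x
  sum-is x f = trans (sum-single _ x λ u u≢x → cong (if_then f u else 0) (dec-false (u ≟ᶠ x) u≢x))
                     (cong (if_then f x else 0) (dec-true (x ≟ᶠ x) refl))

  size-delete : ∀ {x} S → S x ≡ true → suc (sum (𝟙 ∘ delete x S)) ≤ sum (𝟙 ∘ S)
  size-delete {x} S x∈S = begin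
    suc (sum (𝟙 ∘ delete x S)) ≡⟨ cong (_+ sum (𝟙 ∘ delete x S)) (sym (sum-is x (λ _ → 1))) ⟩
    sum (λ u → 𝟙 (u is x)) + sum (𝟙 ∘ delete x S) ≡⟨ sym (∑-distrib-+ (λ u → 𝟙 (u is x)) (𝟙 ∘ delete x S)) ⟩
    sum (λ u → 𝟙 (u is x) + 𝟙 (delete x S u)) ≤⟨ sum-mono-≤ pointwise ⟩
    sum (𝟙 ∘ S) ∎
    where
    open ≤-Reasoning
    pointwise : ∀ u → 𝟙 (u is x) + 𝟙 (delete x S u) ≤ 𝟙 (S u)
    pointwise u with u ≟ᶠ x
    ... | yes refl rewrite x∈S = ≤-refl
    ... | no _ with S u
    ...   | true  = ≤-refl
    ...   | false = ≤-refl

  -- A pair inside `S` survives the deletion or has `x` at one end. `B` counts those with `x` first;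
  -- by symmetry those with `x` second are as many.
  arcs-delete : ∀ {x} S → S x ≡ true → arcs S ≤ arcs (delete x S) + (length (nbrsIn S x) + length (nbrsIn S x))
  arcs-delete {x} S x∈S = begin
    arcs S ≤⟨ sum-mono-≤ (λ u → sum-mono-≤ (pointwise u)) ⟩
    sum (λ u → sum (λ v → A u v + (B u v + B v u)))
      ≡⟨ ∑∑-distrib-+ A (λ u v → B u v + B v u) ⟩
    arcs S′ + sum (λ u → sum (λ v → B u v + B v u))
      ≡⟨ cong (arcs S′ +_) (∑∑-distrib-+ B (λ u v → B v u)) ⟩
    arcs S′ + (sum (λ u → sum (λ v → B u v)) + sum (λ u → sum (λ v → B v u)))
      ≡⟨ cong (λ t → arcs S′ + (sum (λ u → sum (λ v → B u v)) + t)) (∑-comm (λ u v → B v u)) ⟩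
    arcs S′ + (sum (λ u → sum (λ v → B u v)) + sum (λ u → sum (λ v → B u v)))
      ≡⟨ cong (λ t → arcs S′ + (t + t)) sum-B ⟩
    arcs S′ + (length (nbrsIn S x) + length (nbrsIn S x)) ∎
    where
    open ≤-Reasoning
    S′ = delete x S
    A B : Fin n → Fin n → ℕ
    A u v = 𝟙 (S′ u ∧ S′ v ∧ G u v)
    B u v = if u is x then 𝟙 (S v ∧ G u v) else 0
    ∑∑-distrib-+ : (f g : Fin n → Fin n → ℕ) →
      sum (λ u → sum (λ v → f u v + g u v)) ≡ sum (λ u → sum (f u)) + sum (λ u → sum (g u))
    ∑∑-distrib-+ f g = trans (sum-cong-≗ λ u → ∑-distrib-+ (f u) (g u))
                             (∑-distrib-+ (λ u → sum (f u)) (λ u → sum (g u)))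
    sum-B : sum (λ u → sum (λ v → B u v)) ≡ length (nbrsIn S x)
    sum-B = trans (∑-comm B) (trans (sum-cong-≗ λ v → sum-is x (λ u → 𝟙 (S v ∧ G u v)))
                                    (sym (length-members (λ v → S v ∧ G x v))))
    pointwise : ∀ u v → 𝟙 (S u ∧ S v ∧ G u v) ≤ A u v + (B u v + B v u)
    pointwise u v with u ≟ᶠ x | v ≟ᶠ x
    ... | yes refl | _ rewrite x∈S = m≤m+n _ _
    ... | no _ | yes refl rewrite x∈S | symm u v = m≤n+m _ (𝟙 ((S u ∧ true) ∧ (true ∧ false) ∧ G v u))
    ... | no _ | no _ rewrite ∧-identityʳ (S u) | ∧-identityʳ (S v) = m≤m+n _ _

  arcs>0⇒nonempty : ∀ S → 0 < arcs S → ∃ λ x → S x ≡ true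
  arcs>0⇒nonempty S pos with any? (λ x → S x ≟ᵇ true)
  ... | yes p = p
  ... | no ¬p = contradiction (sum-zero λ u → sum-zero λ v → cong 𝟙 (empty u v)) (≢-sym (<⇒≢ pos))
    where
    empty : ∀ u v → (S u ∧ S v ∧ G u v) ≡ false
    empty u v with S u in eq
    ... | true  = contradiction (u , eq) ¬p
    ... | false = refl

  MinDegree> : ℕ → (Fin n → Bool) → Set
  MinDegree> b S = ∀ {x} → S x ≡ true → b < length (nbrsIn S x)

  -- Deleting a vertex with at most `b` neighbours in `S` costs at most `2b` arcs, so the excess
  -- over `2b` per vertex persists. The bound `m` on the size ends the process, and the remaining
  -- arcs show that the result is nonempty.
  peel : ∀ b m S → sum (𝟙 ∘ S) ≤ m → m * (b + b) < arcs S → ∃ λ S′ → (∃ λ x → S′ x ≡ true) × MinDegree> b S′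
  peel b m S size dense with any? (λ x → (S x ≟ᵇ true) ×-dec (length (nbrsIn S x) ≤? b))
  ... | no ¬p = S , arcs>0⇒nonempty S (≤-<-trans z≤n dense) , λ {x} x∈S → ≰⇒> λ small → ¬p (x , x∈S , small)
  peel b zero S size dense | yes (x , x∈S , _) with () ← ≤-trans (size-delete S x∈S) size
  peel b (suc m) S size dense | yes (x , x∈S , small) =
    peel b m (delete x S) (s≤s⁻¹ (≤-trans (size-delete S x∈S) size))
      (+-cancelˡ-< (b + b) _ _ (<-≤-trans dense (≤-trans (arcs-delete S x∈S)
        (≤-trans (+-monoʳ-≤ (arcs (delete x S)) (+-mono-≤ small small)) (≤-reflexive (+-comm (arcs (delete x S)) _))))))

-- The upper bound

module _ {n} (G : Graph n) where

  ball : ℕ → Fin n → List (Fin n)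
  ball zero    v = v ∷ []
  ball (suc r) v = concatMap (ball r) (v ∷ nbrs G v)

  length-concatMap-≤ : ∀ {M} (f : Fin n → List (Fin n)) xs → (∀ x → length (f x) ≤ M) →
    length (concatMap f xs) ≤ length xs * M
  length-concatMap-≤ f []       _ = z≤n
  length-concatMap-≤ f (x ∷ xs) h = ≤-trans (≤-reflexive (length-++ (f x)))
    (+-mono-≤ (h x) (length-concatMap-≤ f xs h))

  -- Degrees below `Δ` leave at most `Δ` continuations, the vertex itself included. Since `ball` is
  -- a list with repetitions, lengths simply multiply.
  length-ball : ∀ {Δ} → (∀ u → degree G u < Δ) → ∀ r v → length (ball r v) ≤ Δ ^ r
  length-ball deg< zero    v = ≤-refl
  length-ball {Δ} deg< (suc r) v = ≤-trans
    (length-concatMap-≤ (ball r) (v ∷ nbrs G v) (length-ball deg< r))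
    (*-monoˡ-≤ (Δ ^ r) (deg< v))

  near⇒∈ball : ∀ {z} r {v} → Near G (_≟ᶠ z) r v → z ∈ ball r v
  near⇒∈ball zero        refl = here refl
  near⇒∈ball {z} (suc r) {v} p = ∈-concatMap⁺ (ball r) {v ∷ nbrs G v} (Any.map (near⇒∈ball r) p)

  ∃-distant : ∀ {Δ} → (∀ u → degree G u < Δ) → ∀ r → Δ ^ r < n → ∀ v → ∃ λ z → ¬ Near G (_≟ᶠ z) r v
  ∃-distant deg< r n-large v with ∃-fresh (allFin⁺ n)
    (≤-<-trans (length-ball deg< r v) (<-≤-trans n-large (≤-reflexive (sym (length-tabulate id)))))
  ... | z , _ , z∉ = z , z∉ ∘ near⇒∈ball r

  sum-degree : sum (degree G) ≡ sum (λ u → sum (λ v → 𝟙 (G u v)))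
  sum-degree = sum-cong-≗ λ u → length-members (G u)

  sum-degree-≤ : ∀ {d} → (∀ u → degree G u ≤ d) → sum (degree G) ≤ n * d
  sum-degree-≤ deg≤ = ≤-trans (sum-mono-≤ deg≤) (≤-reflexive (sum-const n _))

  module _ (simple : IsSimple G) (conn : Connected G) where

    private
      symm = proj₁ simple
      loopless = proj₂ simple

    adj⇒≢ : ∀ {u v} → Adj G u v → v ≢ u
    adj⇒≢ {u} u~v refl with () ← trans (sym (loopless u)) u~v

    -- Here `a = suc b`. The path of `b` edges from `w` runs into the peeled subgraph, and `w` has
    -- enough neighbours to lose any `b` of them.
    high-degree⇒broom : ∀ {k b} → b + b ≤ k ∸ suc b → n * (k ∸ suc b) < sum (degree G) →
      ∀ w → k ∸ 1 ≤ degree G w → Contains G (broom k (suc b))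
    high-degree⇒broom {k} {b} b-small dense w high
      -- The full vertex set has the degree sum as its number of arcs, which exceeds `n * (b + b)`
      -- by `b-small`.
      with peel G symm b n (λ _ → true) (≤-reflexive (trans (sum-const n 1) (*-identityʳ n)))
             (≤-<-trans (*-monoʳ-≤ n b-small) (<-≤-trans dense (≤-reflexive sum-degree)))
    ... | S , (z , z∈S) , large with long-path G (λ x → S x ≟ᵇ true) (nbrsIn G symm S)
            (λ x → members-unique (λ y → S y ∧ G x y))
            (λ {x} {y} y∈ → case ∧-true⁻ (S y) (∈-members⁻ (λ y → S y ∧ G x y) y∈) of λ (y∈S , x~y) → x~y , y∈S)
            large conn z∈S w
    ... | ys , len , linked , ys! , fresh =
      contains-broom G symm w ys (remove ys (nbrs G w)) (cong suc len) linked
        (All.map (λ y∉ w≡y → y∉ (here (sym w≡y))) fresh ∷ ys!)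
        (filter⁺ (λ x → ¬? (x ∈? ys)) (members-unique (G w))) leaf enough
      where
      leaf : ∀ {x} → x ∈ remove ys (nbrs G w) → Adj G w x × x ∉ w ∷ ys
      leaf x∈ with ∈-filter⁻ (λ x → ¬? (x ∈? ys)) {xs = nbrs G w} x∈
      ... | x∈nbrs , x∉ys = w~x , λ { (here x≡w) → adj⇒≢ w~x x≡w ; (there x∈ys) → x∉ys x∈ys }
        where w~x = ∈-members⁻ (G w) x∈nbrs
      -- Of at least `k − 1` neighbours at most `b` lie on the path, leaving `k − 1 − b = k − a`.
      enough : k ∸ suc b ≤ length (remove ys (nbrs G w))
      enough = ≤-trans (≤-reflexive (sym (∸-+-assoc k 1 b))) (m≤n+o⇒m∸n≤o (k ∸ 1) b
        (≤-trans high (≤-trans (length≤remove+length ys (members-unique (G w)))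
          (≤-reflexive (trans (cong (length (remove ys (nbrs G w)) +_) len) (+-comm _ b))))))

    -- Here `a = suc (suc b)`. Balls of radius `b` are too small to cover the graph, so some `z` is
    -- at distance at least `b + 1 = a − 1` from `v`. The shortest path towards it takes the first
    -- step to `y` and then `b` steps that avoid all neighbours of `v`; the strict degree bound pays
    -- for `y`.
    low-degree⇒broom : ∀ {k b} → (∀ u → degree G u < k ∸ 1) → (k ∸ 1) ^ b < n →
      ∀ v → k ∸ suc (suc b) < degree G v → Contains G (broom k (suc (suc b)))
    low-degree⇒broom {k} {b} low n-large v high with ∃-distant low b n-large v
    ... | z , ¬near with walk⇒near G (_≟ᶠ z) (conn v z) refl
    ... | r , near with geodesic-start G (_≟ᶠ z) b {v} (case exact-distance G (_≟ᶠ z) b r ¬near near of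
                          λ (s , b≤s , p , ¬p) → s , b≤s , p , ¬p , [])
    ... | y , v~y , y≢v , geo with grow G (Geodesic G (_≟ᶠ z)) (geodesic-next G (_≟ᶠ z)) b geo
    ... | ys , len , linked , ys! , fresh =
      contains-broom G symm v (y ∷ ys) (remove (y ∷ []) (nbrs G v)) (cong (λ l → suc (suc l)) len) (v~y ∷ linked)
        ((≢-sym y≢v ∷ All.map (λ z∉ v≡z → z∉ (there (here (sym v≡z)))) fresh)
          ∷ All.map (λ z∉ y≡z → z∉ (here (sym y≡z))) fresh ∷ ys!)
        (filter⁺ (λ x → ¬? (x ∈? y ∷ [])) (members-unique (G v))) leaf enough
      where
      leaf : ∀ {x} → x ∈ remove (y ∷ []) (nbrs G v) → Adj G v x × x ∉ v ∷ y ∷ ys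
      leaf x∈ with ∈-filter⁻ (λ x → ¬? (x ∈? y ∷ [])) {xs = nbrs G v} x∈
      ... | x∈nbrs , x≢y = v~x ,
        λ { (here x≡v)             → adj⇒≢ v~x x≡v
          ; (there (here x≡y))     → x≢y (here x≡y)
          ; (there (there x∈ys))   → All.lookup fresh x∈ys (there (there x∈nbrs)) }
        where v~x = ∈-members⁻ (G v) x∈nbrs
      enough : k ∸ suc (suc b) ≤ length (remove (y ∷ []) (nbrs G v))
      enough = s≤s⁻¹ (≤-trans high (≤-trans (length≤remove+length (y ∷ []) (members-unique (G v)))
        (≤-reflexive (+-comm _ 1))))

    -- More than `⌊ d * n /2⌋` edges would make the degree sum exceed `n * d`, so some degree
    -- exceeds `d`; the two broom lemmas split on whether some degree reaches `k ∸ 1`.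
    edges-≤ : ∀ {k b} → suc b + suc b ≤ k ∸ suc (suc b) → (k ∸ 1) ^ b < n →
      ¬ Contains G (broom k (suc (suc b))) → edgeCount G ≤ ⌊ (k ∸ suc (suc b)) * n /2⌋
    edges-≤ {k} {b} b-small n-large free = decidable-stable (edgeCount G ≤? ⌊ d * n /2⌋) λ e≰ → free (broom! (dense e≰))
      where
      d = k ∸ suc (suc b)
      dense : ¬ edgeCount G ≤ ⌊ d * n /2⌋ → n * d < sum (degree G)
      dense e≰ = ≰⇒> λ deg≤ → e≰ (≤-trans (≤-reflexive (n≡⌊n+n/2⌋ (edgeCount G)))
        (⌊n/2⌋-mono (≤-trans (≤-reflexive (trans (sym (handshake G simple)) (sym sum-degree)))
          (≤-trans deg≤ (≤-reflexive (*-comm n d))))))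
      broom! : n * d < sum (degree G) → Contains G (broom k (suc (suc b)))
      broom! dn< with any? (λ w → k ∸ 1 ≤? degree G w)
      ... | yes (w , high) = high-degree⇒broom b-small dn< w high
      ... | no ¬high with any? (λ v → d <? degree G v)
      ... | yes (v , high) = low-degree⇒broom (λ u → ≰⇒> λ h → ¬high (u , h)) n-large v high
      ... | no ¬v = contradiction (sum-degree-≤ λ u → ≮⇒≥ λ h → ¬v (u , h)) (<⇒≱ dn<)

-- Constructions

module _ {n} {G : Graph n} where

  walk-snoc : ∀ {u v w} → Walk G u v → G v w ≡ true → Walk G u w
  walk-snoc here       e = step e here
  walk-snoc (step d p) e = step d (walk-snoc p e)

  walk-trans : ∀ {u v w} → Walk G u v → Walk G v w → Walk G u w
  walk-trans here       q = q
  walk-trans (step d p) q = step d (walk-trans p q)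

  walk-reverse : (∀ u v → G u v ≡ G v u) → ∀ {u v} → Walk G u v → Walk G v u
  walk-reverse symm here       = here
  walk-reverse symm (step d p) = walk-snoc (walk-reverse symm p) (trans (symm _ _) d)

  connected-from : (∀ u v → G u v ≡ G v u) → ∀ r → (∀ v → Walk G r v) → Connected G
  connected-from symm r reach u v = walk-trans (walk-reverse symm (reach u)) (reach v)

sum-all : ∀ {n c} {f : Fin n → ℕ} → (∀ i → f i ≡ c) → sum f ≡ n * c
sum-all {n} {c} f≡c = trans (sum-cong-≗ f≡c) (sum-const n c)

graph : ∀ {n} {R : ℕ → ℕ → Set} → Decidable₂ R → Graph n
graph R? u v = does (R? (toℕ u) (toℕ v))

graph-simple : ∀ {n} {R : ℕ → ℕ → Set} (R? : Decidable₂ R) →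
  (∀ {i j} → R i j → R j i) → (∀ i → ¬ R i i) → IsSimple {n} (graph R?)
graph-simple R? R-sym R-irrefl =
  (λ u v → does-⇔ (mk⇔ R-sym R-sym) (R? (toℕ u) (toℕ v)) (R? (toℕ v) (toℕ u))) ,
  (λ u → dec-false (R? (toℕ u) (toℕ u)) (R-irrefl (toℕ u)))

-- Advancing u by one drops the last term of the row and prepends an equal one.
sum-∣-∣ : ∀ {n} (f : ℕ → ℕ) → (∀ {i} → 0 < i → i < n → f i ≡ f (n ∸ i)) →
  ∀ u → u < n → sum {n} (λ v → f ∣ u - toℕ v ∣) ≡ sum {n} (f ∘ toℕ)
sum-∣-∣ f f-sym zero    _ = refl
sum-∣-∣ {suc n} f f-sym (suc u) su<n = begin
  f (suc u) + sum {n} (λ v → f ∣ u - toℕ v ∣)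
    ≡⟨ +-comm (f (suc u)) _ ⟩
  sum {n} (λ v → f ∣ u - toℕ v ∣) + f (suc u)
    ≡⟨ cong (sum {n} (λ v → f ∣ u - toℕ v ∣) +_) (trans (f-sym z<s su<n) (cong f (sym (m≤n⇒∣m-n∣≡n∸m u≤n)))) ⟩
  sum {n} (λ v → f ∣ u - toℕ v ∣) + f ∣ u - n ∣
    ≡⟨ sym (sum-last n (λ j → f ∣ u - j ∣)) ⟩
  sum {suc n} (λ v → f ∣ u - toℕ v ∣)
    ≡⟨ sum-∣-∣ f f-sym u (<-trans (n<1+n u) su<n) ⟩
  sum {suc n} (f ∘ toℕ) ∎
  where
  open ≡-Reasoning
  u≤n : u ≤ n
  u≤n = <⇒≤ (s<s⁻¹ su<n)

double-injective : ∀ {m n} → m + m ≡ n + n → m ≡ n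
double-injective {m} {n} eq = trans (n≡⌊n+n/2⌋ m) (trans (cong ⌊_/2⌋ eq) (sym (n≡⌊n+n/2⌋ n)))

⌊2m+n/2⌋ : ∀ m n → ⌊ m + m + n /2⌋ ≡ m + ⌊ n /2⌋
⌊2m+n/2⌋ zero    n = refl
⌊2m+n/2⌋ (suc m) n rewrite +-suc m m = cong suc (⌊2m+n/2⌋ m n)

parity : ∀ d → ∃ λ h → d ≡ h + h ⊎ d ≡ suc (h + h)
parity zero = 0 , inj₁ refl
parity (suc d) with parity d
... | h , inj₁ refl = h , inj₂ refl
... | h , inj₂ refl = suc h , inj₁ (cong suc (sym (+-suc h h)))

⌊n/2⌋+⌊n/2⌋≤n : ∀ n → ⌊ n /2⌋ + ⌊ n /2⌋ ≤ n
⌊n/2⌋+⌊n/2⌋≤n n = ≤-trans (+-monoʳ-≤ ⌊ n /2⌋ (⌊n/2⌋≤⌈n/2⌉ n)) (≤-reflexive (⌊n/2⌋+⌈n/2⌉≡n n))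

-- Circulant graphs with an added matching

module _ (n h : ℕ) where

  -- For an offset `i` between two of `n` points on a circle: going one way round or the other takes
  -- at most `h` steps. The second case is `n − i ≤ h` without truncated subtraction.
  Circ : ℕ → Set
  Circ i = (0 < i × i ≤ h) ⊎ n ≤ i + h

  circ? : Decidable Circ
  circ? i = ((0 <? i) ×-dec (i ≤? h)) ⊎-dec (n ≤? i + h)

  circ-flip : ∀ {i} → i < n → Circ i → Circ (n ∸ i)
  circ-flip {i} i<n (inj₁ (_ , i≤h)) =
    inj₂ (≤-trans (≤-reflexive (sym (m∸n+n≡m (<⇒≤ i<n)))) (+-monoʳ-≤ (n ∸ i) i≤h))
  circ-flip {i} i<n (inj₂ n≤i+h) = inj₁ (m<n⇒0<n∸m i<n , m≤n+o⇒m∸n≤o n i n≤i+h)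

  -- Reflection of `i` to `n ∸ i` exchanges the two cases of `Circ`; `sum-∣-∣` needs this symmetry
  -- to make all rows equal.
  circ-symmetric : ∀ {i} → 0 < i → i < n → 𝟙 (does (circ? i)) ≡ 𝟙 (does (circ? (n ∸ i)))
  circ-symmetric {i} 0<i i<n = cong 𝟙 (does-⇔ (mk⇔ (circ-flip i<n) unflip) (circ? i) (circ? (n ∸ i)))
    where
    unflip : Circ (n ∸ i) → Circ i
    unflip c = subst Circ (m∸[m∸n]≡n (<⇒≤ i<n))
      (circ-flip (∸-monoʳ-< 0<i (<⇒≤ i<n)) c)

-- The row of vertex 0 is cut into offset 0, then `h` offsets that count, `t` that do not, and `h`
-- that count again.
sum-circ : ∀ h t → sum {suc h + (t + h)} (λ i → 𝟙 (does (circ? (suc h + (t + h)) h (toℕ i)))) ≡ h + h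
sum-circ h t = begin
  sum {n} (C ∘ toℕ)                                   ≡⟨ sum-split (suc h) {t + h} C ⟩
  sum {suc h} (C ∘ toℕ) + sum {t + h} (C′ ∘ toℕ)      ≡⟨ cong (sum {suc h} (C ∘ toℕ) +_) (sum-split t {h} C′) ⟩
  sum {suc h} (C ∘ toℕ) + (sum {t} (C′ ∘ toℕ) + sum {h} (λ i → C′ (t + toℕ i)))
    ≡⟨ cong₂ _+_ (cong₂ _+_ C0 (sum-all C-low)) (cong₂ _+_ (sum-zero {t} C-mid) (sum-all C-high)) ⟩
  h * 1 + h * 1                                       ≡⟨ cong₂ _+_ (*-identityʳ h) (*-identityʳ h) ⟩
  h + h ∎
  where
  open ≡-Reasoning
  n = suc h + (t + h)
  C C′ : ℕ → ℕ
  C i  = 𝟙 (does (circ? n h i))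
  C′ i = C (suc h + i)
  C0 : C 0 ≡ 0
  C0 = cong 𝟙 (dec-false (circ? n h 0) λ { (inj₁ ()) ; (inj₂ n≤h) → <⇒≱ (m≤m+n (suc h) (t + h)) n≤h })
  C-low : ∀ (i : Fin h) → C (suc (toℕ i)) ≡ 1
  C-low i = cong 𝟙 (dec-true (circ? n h (suc (toℕ i))) (inj₁ (z<s , toℕ<n i)))
  C-mid : ∀ (i : Fin t) → C′ (toℕ i) ≡ 0
  C-mid i = cong 𝟙 (dec-false (circ? n h (suc h + toℕ i)) λ
    { (inj₁ (_ , le)) → <⇒≱ (m≤m+n (suc h) (toℕ i)) le
    ; (inj₂ n≤) → <⇒≱ (+-monoʳ-< (suc h) (+-monoˡ-< h (toℕ<n i)))
                      (≤-trans n≤ (≤-reflexive (+-assoc (suc h) (toℕ i) h))) })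
  C-high : ∀ (i : Fin h) → C′ (t + toℕ i) ≡ 1
  C-high i = cong 𝟙 (dec-true (circ? n h (suc h + (t + toℕ i))) (inj₂
    (≤-trans (+-monoʳ-≤ (suc h) (+-monoˡ-≤ h (m≤m+n t (toℕ i)))) (≤-reflexive (sym (+-assoc (suc h) (t + toℕ i) h))))))

module Harary (n h q : ℕ) (1≤h : 1 ≤ h) (2h<n : h + h < n) (2q≤n : q + q ≤ n) (h<q : 0 < q → h < q) where

  -- The bounds make this a perfect matching of the vertices below `2q`; for `q = 0` they make it
  -- empty, where the equation alone would be the diagonal.
  Match : ℕ → ℕ → Set
  Match i j = ∣ i - j ∣ ≡ q × i < q + q × j < q + q

  match? : Decidable₂ Match
  match? i j = (∣ i - j ∣ ≟ q) ×-dec ((i <? q + q) ×-dec (j <? q + q))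

  Edge : ℕ → ℕ → Set
  Edge i j = Circ n h ∣ i - j ∣ ⊎ Match i j

  edge? : Decidable₂ Edge
  edge? i j = circ? n h ∣ i - j ∣ ⊎-dec match? i j

  -- The circulant graph on offsets 1, …, h, together with q edges joining i to i + q for i < q.
  harary : Graph n
  harary = graph edge?

  h<n : h < n
  h<n = ≤-<-trans (m≤m+n h h) 2h<n

  match⇒0<q : ∀ {i j} → Match i j → 0 < q
  match⇒0<q {i} (_ , i<2q , _) = n≢0⇒n>0 λ q≡0 → n≮0 (subst (λ q → i < q + q) q≡0 i<2q)

  harary-simple : IsSimple harary
  harary-simple = graph-simple edge? edge-sym edge-irrefl
    where
    edge-sym : ∀ {i j} → Edge i j → Edge j i
    edge-sym {i} {j} (inj₁ c) = inj₁ (subst (Circ n h) (∣-∣-comm i j) c)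
    edge-sym {i} {j} (inj₂ (eq , i< , j<)) = inj₂ (trans (∣-∣-comm j i) eq , j< , i<)
    edge-irrefl : ∀ i → ¬ Edge i i
    edge-irrefl i (inj₁ c) with ∣ i - i ∣ | ∣n-n∣≡0 i
    edge-irrefl i (inj₁ (inj₂ n≤h)) | _ | refl = <⇒≱ h<n n≤h
    edge-irrefl i (inj₂ m@(eq , _)) = <⇒≢ (match⇒0<q {i} {i} m) (trans (sym (∣n-n∣≡0 i)) eq)

  -- A matched pair has offset `q`, which lies strictly between `h` and `n − h` because `h < q` and
  -- `2q ≤ n`.
  disjoint : ∀ {i j} → Circ n h ∣ i - j ∣ → ¬ Match i j
  disjoint {i} {j} c m@(refl , _) with h<q (match⇒0<q {i} {j} m) | c
  ... | lt | inj₁ (_ , le) = <⇒≱ lt le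
  ... | lt | inj₂ n≤ = <⇒≱ (<-≤-trans (+-monoʳ-< ∣ i - j ∣ lt) 2q≤n) n≤

  edge-indicator : ∀ i j → 𝟙 (does (edge? i j)) ≡ 𝟙 (does (circ? n h ∣ i - j ∣)) + 𝟙 (does (match? i j))
  edge-indicator i j = go (circ? n h ∣ i - j ∣) (match? i j)
    where
    go : (c : Dec (Circ n h ∣ i - j ∣)) (m : Dec (Match i j)) →
      𝟙 (does (c ⊎-dec m)) ≡ 𝟙 (does c) + 𝟙 (does m)
    go (yes c) (yes m) = contradiction m (disjoint c)
    go (yes _) (no _)  = refl
    go (no _)  _       = refl

  -- Of `i + q` and `i − q` exactly one is in range: the second needs `q ≤ i`, and then the first is
  -- at least `2q`.
  partner : ∀ {i} → i < q + q → ∃ λ j → Match i j × (∀ {l} → Match i l → l ≡ j)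
  partner {i} i<2q with i <? q
  ... | yes i<q = i + q , (∣m-m+n∣≡n i q , i<2q , +-monoˡ-< q i<q) , unique
    where
    unique : ∀ {l} → Match i l → l ≡ i + q
    unique {l} (eq , _ , _) with ≤-total i l
    ... | inj₁ i≤l = trans (sym (m+[n∸m]≡n i≤l)) (cong (i +_) (trans (sym (m≤n⇒∣m-n∣≡n∸m i≤l)) eq))
    ... | inj₂ l≤i = contradiction (≤-trans (≤-reflexive (trans (sym eq) (m≤n⇒∣n-m∣≡n∸m l≤i))) (m∸n≤m i l)) (<⇒≱ i<q)
  ... | no i≮q = i ∸ q , (trans (m≤n⇒∣n-m∣≡n∸m (m∸n≤m i q)) (m∸[m∸n]≡n q≤i) , i<2q , ≤-<-trans (m∸n≤m i q) i<2q) , unique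
    where
    q≤i = ≮⇒≥ i≮q
    unique : ∀ {l} → Match i l → l ≡ i ∸ q
    unique {l} (eq , _ , l<2q) with ≤-total i l
    ... | inj₂ l≤i = trans (sym (m∸[m∸n]≡n l≤i)) (cong (i ∸_) (trans (sym (m≤n⇒∣n-m∣≡n∸m l≤i)) eq))
    ... | inj₁ i≤l = contradiction (subst (q + q ≤_) (m+[n∸m]≡n i≤l)
            (+-mono-≤ q≤i (≤-reflexive (trans (sym eq) (m≤n⇒∣m-n∣≡n∸m i≤l))))) (<⇒≱ l<2q)

  sum-match : ∀ i → sum {n} (λ v → 𝟙 (does (match? i (toℕ v)))) ≡ 𝟙 (does (i <? q + q))
  sum-match i = go (i <? q + q)
    where
    go : (i<2q? : Dec (i < q + q)) → sum {n} (λ v → 𝟙 (does (match? i (toℕ v)))) ≡ 𝟙 (does i<2q?)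
    go (no i≮) = sum-zero {n} λ v → cong 𝟙 (dec-false (match? i (toℕ v)) λ (_ , i< , _) → i≮ i<)
    go (yes i<) with partner i<
    ... | j , m@(_ , _ , j<2q) , unique =
      trans (sum-single _ w λ v v≢w → cong 𝟙 (dec-false (match? i (toℕ v)) λ m′ →
              v≢w (toℕ-injective (trans (unique m′) (sym w≡j)))))
            (cong 𝟙 (dec-true (match? i (toℕ w)) (subst (Match i) (sym w≡j) m)))
      where
      j<n = <-≤-trans j<2q 2q≤n
      w = fromℕ< j<n
      w≡j : toℕ w ≡ j
      w≡j = toℕ-fromℕ< j<n

  sum-circ-row : ∀ i → i < n → sum {n} (λ v → 𝟙 (does (circ? n h ∣ i - toℕ v ∣))) ≡ h + h
  sum-circ-row i i<n = trans (sum-∣-∣ (λ l → 𝟙 (does (circ? n h l))) (circ-symmetric n h) i i<n)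
    (subst (λ n → sum {n} (λ v → 𝟙 (does (circ? n h (toℕ v)))) ≡ h + h) size (sum-circ h (n ∸ suc (h + h))))
    where
    -- The middle block consists of `n − (2h + 1)` offsets.
    size : suc h + ((n ∸ suc (h + h)) + h) ≡ n
    size = trans (cong (λ t → suc (h + t)) (+-comm (n ∸ suc (h + h)) h))
      (trans (cong suc (sym (+-assoc h h _))) (m+[n∸m]≡n 2h<n))

  row : ∀ (u : Fin n) → sum (λ v → 𝟙 (harary u v)) ≡ (h + h) + 𝟙 (does (toℕ u <? q + q))
  row u = trans (sum-cong-≗ {n} λ v → edge-indicator (toℕ u) (toℕ v))
    (trans (∑-distrib-+ {n} (λ v → 𝟙 (does (circ? n h ∣ toℕ u - toℕ v ∣))) (λ v → 𝟙 (does (match? (toℕ u) (toℕ v)))))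
      (cong₂ _+_ (sum-circ-row (toℕ u) (toℕ<n u)) (sum-match (toℕ u))))

  harary-degree : ∀ u → degree harary u ≡ (h + h) + 𝟙 (does (toℕ u <? q + q))
  harary-degree u = trans (length-members (harary u)) (row u)

  harary-edges : edgeCount harary ≡ n * h + q
  harary-edges = double-injective (begin
    edgeCount harary + edgeCount harary
      ≡⟨ sym (handshake harary harary-simple) ⟩
    sum (λ u → sum (λ v → 𝟙 (harary u v)))
      ≡⟨ sum-cong-≗ row ⟩
    sum {n} (λ u → (h + h) + 𝟙 (does (toℕ u <? q + q)))
      ≡⟨ ∑-distrib-+ {n} (λ _ → h + h) (λ u → 𝟙 (does (toℕ u <? q + q))) ⟩
    sum {n} (λ _ → h + h) + sum {n} (λ u → 𝟙 (does (toℕ u <? q + q)))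
      ≡⟨ cong₂ _+_ (sum-const n (h + h)) below ⟩
    n * (h + h) + (q + q)
      ≡⟨ solve 3 (λ n h q → n :* (h :+ h) :+ (q :+ q) := (n :* h :+ q) :+ (n :* h :+ q)) refl n h q ⟩
    (n * h + q) + (n * h + q) ∎)
    where
    open ≡-Reasoning
    open +-*-Solver
    L : ℕ → ℕ
    L i = 𝟙 (does (i <? q + q))
    below : sum {n} (L ∘ toℕ) ≡ q + q
    below = begin
      sum {n} (L ∘ toℕ)
        ≡⟨ cong (λ m → sum {m} (L ∘ toℕ)) (sym (m+[n∸m]≡n 2q≤n)) ⟩
      sum {(q + q) + (n ∸ (q + q))} (L ∘ toℕ)
        ≡⟨ sum-split (q + q) {n ∸ (q + q)} L ⟩
      sum {q + q} (L ∘ toℕ) + sum {n ∸ (q + q)} (λ i → L ((q + q) + toℕ i))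
        ≡⟨ cong₂ _+_ (sum-all {q + q} λ i → cong 𝟙 (dec-true (toℕ i <? q + q) (toℕ<n i)))
                     (sum-zero {n ∸ (q + q)} λ i → cong 𝟙 (dec-false ((q + q) + toℕ i <? q + q) (≤⇒≯ (m≤m+n (q + q) (toℕ i))))) ⟩
      (q + q) * 1 + 0
        ≡⟨ trans (+-identityʳ _) (*-identityʳ _) ⟩
      q + q ∎

-- Consecutive vertices have offset `1 ≤ h`, so the graph contains the path through all vertices in
-- order.
harary-connected : ∀ n h q 1≤h 2h<n 2q≤n h<q → Connected (Harary.harary n h q 1≤h 2h<n 2q≤n h<q)
harary-connected (suc n) h q 1≤h 2h<n 2q≤n h<q =
  connected-from (proj₁ harary-simple) zero (<-weakInduction (Walk harary zero) here λ i p → walk-snoc p (next i))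
  where
  open Harary (suc n) h q 1≤h 2h<n 2q≤n h<q
  next : ∀ i → harary (inject₁ i) (suc i) ≡ true
  next i = dec-true (edge? (toℕ (inject₁ i)) (suc (toℕ i))) (inj₁ (subst (Circ (suc n) h) (sym gap) (inj₁ (z<s , 1≤h))))
    where
    gap : ∣ toℕ (inject₁ i) - suc (toℕ i) ∣ ≡ 1
    gap = trans (cong₂ ∣_-_∣ (toℕ-inject₁ i) (sym (+-comm (toℕ i) 1))) (∣m-m+n∣≡n (toℕ i) 1)

nearly-regular : ∀ d n → 2 ≤ d → d < n → Σ (Graph n) λ G →
  IsSimple G × Connected G × (∀ u → degree G u ≤ d) × edgeCount G ≡ ⌊ d * n /2⌋
nearly-regular d n 2≤d d<n with parity d
... | h , inj₁ refl = harary , harary-simple , harary-connected n h 0 1≤h d<n z≤n (λ ()) ,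
        (λ u → ≤-reflexive (trans (harary-degree u) (+-identityʳ _))) ,
        trans harary-edges (trans (+-identityʳ _) (trans (n≡⌊n+n/2⌋ (n * h)) (cong ⌊_/2⌋
          (solve 2 (λ n h → n :* h :+ n :* h := (h :+ h) :* n) refl n h))))
  where
  1≤h : 1 ≤ h
  1≤h = ≤-trans (⌊n/2⌋-mono 2≤d) (≤-reflexive (sym (n≡⌊n+n/2⌋ h)))
  open Harary n h 0 1≤h d<n z≤n (λ ())
  open +-*-Solver
... | h , inj₂ refl = harary , harary-simple , harary-connected n h q 1≤h 2h<n 2q≤n (λ _ → h<q) ,
        (λ u → ≤-trans (≤-reflexive (harary-degree u)) (≤-trans (+-monoʳ-≤ (h + h) (𝟙≤1 (does (toℕ u <? q + q)))) (≤-reflexive (+-comm (h + h) 1)))) ,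
        trans harary-edges (trans (sym (⌊2m+n/2⌋ (n * h) n)) (cong ⌊_/2⌋
          (solve 2 (λ n h → n :* h :+ n :* h :+ n := (con 1 :+ (h :+ h)) :* n) refl n h)))
  where
  -- This adds `⌊ n /2⌋` edges to the `n * h` of the circulant; for odd `n` the one unmatched vertex
  -- keeps degree `2h`.
  q = ⌊ n /2⌋
  1≤h : 1 ≤ h
  1≤h = n≢0⇒n>0 λ h≡0 → <⇒≱ 2≤d (≤-reflexive (cong (λ h → suc (h + h)) h≡0))
  2h<n : h + h < n
  2h<n = <-trans (n<1+n _) d<n
  2q≤n : q + q ≤ n
  2q≤n = ⌊n/2⌋+⌊n/2⌋≤n n
  h<q : h < q
  h<q = ≤-trans (≤-reflexive (cong suc (n≡⌊n+n/2⌋ h))) (⌊n/2⌋-mono d<n)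
  𝟙≤1 : ∀ b → 𝟙 b ≤ 1
  𝟙≤1 true  = ≤-refl
  𝟙≤1 false = z≤n
  open Harary n h q 1≤h 2h<n 2q≤n (λ _ → h<q)
  open +-*-Solver

-- Complete bipartite graphs

module Bipartite (n s : ℕ) where

  Edge : ℕ → ℕ → Set
  Edge i j = (i < s × s ≤ j) ⊎ (j < s × s ≤ i)

  edge? : Decidable₂ Edge
  edge? i j = ((i <? s) ×-dec (s ≤? j)) ⊎-dec ((j <? s) ×-dec (s ≤? i))

  bipartite : Graph n
  bipartite = graph edge?

  bipartite⁻ : ∀ {u v} → bipartite u v ≡ true → toℕ u < s ⊎ toℕ v < s
  bipartite⁻ {u} {v} e = go (edge? (toℕ u) (toℕ v)) e
    where
    go : (d : Dec (Edge (toℕ u) (toℕ v))) → does d ≡ true → toℕ u < s ⊎ toℕ v < s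
    go (yes e) _ = [ inj₁ ∘ proj₁ , inj₂ ∘ proj₁ ]′ e

  bipartite-simple : IsSimple bipartite
  bipartite-simple = graph-simple edge? (λ { (inj₁ e) → inj₂ e ; (inj₂ e) → inj₁ e })
    λ { i (inj₁ (i<s , s≤i)) → <⇒≱ i<s s≤i ; i (inj₂ (i<s , s≤i)) → <⇒≱ i<s s≤i }

  bipartite-connected : 0 < s → s < n → Connected bipartite
  bipartite-connected 0<s s<n = connected-from (proj₁ bipartite-simple) left reach
    where
    left right : Fin n
    left  = fromℕ< (<-trans 0<s s<n)
    right = fromℕ< s<n
    left<s : toℕ left < s
    left<s = ≤-<-trans (≤-reflexive (toℕ-fromℕ< (<-trans 0<s s<n))) 0<s
    s≤right : s ≤ toℕ right
    s≤right = ≤-reflexive (sym (toℕ-fromℕ< s<n))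
    reach : ∀ v → Walk bipartite left v
    reach v with s ≤? toℕ v
    ... | yes s≤v = step (dec-true (edge? (toℕ left) (toℕ v)) (inj₁ (left<s , s≤v))) here
    ... | no s≰v  = step (dec-true (edge? (toℕ left) (toℕ right)) (inj₁ (left<s , s≤right)))
                     (step (dec-true (edge? (toℕ right) (toℕ v)) (inj₂ (≰⇒> s≰v , s≤right))) here)

  -- The pairs (leaf a, 0), (1, 2), …, (2s − 1, 2s) are s + 1 disjoint edges of the broom,
  -- while the s vertices on the left meet every edge.
  bipartite-free : ∀ {k a} → a < k → suc (s + s) ≤ a → ¬ Contains bipartite (broom k a)
  bipartite-free {k} {a} a<k 2s<a (f , f-inj , f-edge) = <-irrefl refl (injective⇒≤ {f = g} g-injective)
    where
    0<a : 0 < a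
    0<a = ≤-<-trans z≤n 2s<a

    -- The number of the pair that a vertex belongs to: rounding up joins `2r − 1` with `2r`, and
    -- the leaf `a` is overridden to share rank 0 with the center.
    rank : ℕ → ℕ
    rank i = if does (i ≟ a) then 0 else ⌈ i /2⌉

    rank-path : ∀ {i} → i < a → rank i ≡ ⌈ i /2⌉
    rank-path {i} i<a = cong (if_then 0 else ⌈ i /2⌉) (dec-false (i ≟ a) (<⇒≢ i<a))

    Chosen : ℕ → Set
    Chosen i = ∃ λ z → toℕ (f z) < s × rank (toℕ z) ≡ i

    choose : ∀ {i j r} → (i<k : i < k) (j<k : j < k) → broom k a (fromℕ< i<k) (fromℕ< j<k) ≡ true →
      rank i ≡ r → rank j ≡ r → Chosen r
    choose i<k j<k e i≡ j≡ with bipartite⁻ {f (fromℕ< i<k)} {f (fromℕ< j<k)} (f-edge _ _ e)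
    ... | inj₁ lt = fromℕ< i<k , lt , trans (cong rank (toℕ-fromℕ< i<k)) i≡
    ... | inj₂ lt = fromℕ< j<k , lt , trans (cong rank (toℕ-fromℕ< j<k)) j≡

    chosen : ∀ i → i ≤ s → Chosen i
    chosen zero _ = choose (<-trans 0<a a<k) a<k
      (broom-leaf _ _ (toℕ-fromℕ< (<-trans 0<a a<k)) (≤-reflexive (sym (toℕ-fromℕ< a<k))))
      (rank-path 0<a) (cong (if_then 0 else ⌈ a /2⌉) (dec-true (a ≟ a) refl))
    chosen (suc i) i<s = choose odd<k even<k
      (broom-path _ _ (trans (cong suc (toℕ-fromℕ< odd<k)) (sym (toℕ-fromℕ< even<k)))
        (subst (_< a) (sym (toℕ-fromℕ< even<k)) even<a))
      (trans (rank-path odd<a) (cong suc (sym (n≡⌊n+n/2⌋ i))))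
      (trans (rank-path even<a) (cong suc (trans (cong ⌊_/2⌋ (+-comm 1 (i + i))) (trans (⌊2m+n/2⌋ i 1) (+-identityʳ i)))))
      where
      even<a : suc (suc (i + i)) < a
      even<a = ≤-<-trans (≤-trans (≤-reflexive (cong suc (sym (+-suc i i)))) (+-mono-≤ i<s i<s)) 2s<a
      odd<a : suc (i + i) < a
      odd<a = <-trans (n<1+n _) even<a
      even<k = <-trans even<a a<k
      odd<k = <-trans odd<a a<k

    -- Each of the `s + 1` edges has an end mapped to the left side. Distinct ranks make these ends
    -- distinct, too many for `s` places.
    g : Fin (suc s) → Fin s
    g i = fromℕ< (proj₁ (proj₂ (chosen (toℕ i) (s≤s⁻¹ (toℕ<n i)))))

    g-injective : Injective _≡_ _≡_ g
    g-injective {i} {j} eq with chosen (toℕ i) (s≤s⁻¹ (toℕ<n i)) | chosen (toℕ j) (s≤s⁻¹ (toℕ<n j))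
    ... | z , fz<s , z-rank | w , fw<s , w-rank = toℕ-injective (trans (sym z-rank) (trans (cong (rank ∘ toℕ) z≡w) w-rank))
      where
      z≡w : z ≡ w
      z≡w = f-inj (toℕ-injective (fromℕ<-injective _ _ fz<s fw<s eq))

-- Left vertices have the smaller numbers, so every edge is counted in the row of its left end: `s`
-- rows with `t` entries each.
bipartite-edges : ∀ s t → edgeCount (Bipartite.bipartite (s + t) s) ≡ s * t
bipartite-edges s t = begin
  edgeCount bipartite                              ≡⟨ edgeCount≡sum bipartite ⟩
  sum {s + t} (R ∘ toℕ)                            ≡⟨ sum-split s {t} R ⟩
  sum {s} (R ∘ toℕ) + sum {t} (λ i → R (s + toℕ i))
    ≡⟨ cong₂ _+_ (sum-all {s} λ i → row-left (toℕ<n i)) (sum-zero {t} λ i → row-right (m≤m+n s (toℕ i))) ⟩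
  s * t + 0                                        ≡⟨ +-identityʳ (s * t) ⟩
  s * t ∎
  where
  open ≡-Reasoning
  open Bipartite (s + t) s
  A : ℕ → ℕ → ℕ
  A i j = 𝟙 ((i <ᵇ j) ∧ does (edge? i j))
  R : ℕ → ℕ
  R i = sum {s + t} (λ v → A i (toℕ v))
  A-left : ∀ {i j} → i < s → j < s → A i j ≡ 0
  A-left {i} {j} i<s j<s = cong 𝟙 (trans (cong ((i <ᵇ j) ∧_) (dec-false (edge? i j)
    λ { (inj₁ (_ , s≤j)) → <⇒≱ j<s s≤j ; (inj₂ (_ , s≤i)) → <⇒≱ i<s s≤i })) (∧-zeroʳ (i <ᵇ j)))
  A-cross : ∀ {i j} → i < s → s ≤ j → A i j ≡ 1
  A-cross {i} {j} i<s s≤j = cong 𝟙 (cong₂ _∧_ (<ᵇ-true (<-≤-trans i<s s≤j)) (dec-true (edge? i j) (inj₁ (i<s , s≤j))))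
  row-left : ∀ {i} → i < s → R i ≡ t
  row-left {i} i<s = trans (sum-split s {t} (A i)) (cong₂ _+_ (sum-zero {s} λ v → A-left i<s (toℕ<n v))
    (trans (sum-all {t} λ v → A-cross i<s (m≤m+n s (toℕ v))) (*-identityʳ t)))
  row-right : ∀ {i} → s ≤ i → R i ≡ 0
  row-right {i} s≤i = sum-zero {s + t} λ v → cong 𝟙 (zero-entry (toℕ v))
    where
    zero-entry : ∀ j → (i <ᵇ j) ∧ does (edge? i j) ≡ false
    zero-entry j with i <? j
    ... | no i≮j  = cong (_∧ does (edge? i j)) (<ᵇ-false i≮j)
    ... | yes i<j = trans (cong ((i <ᵇ j) ∧_) (dec-false (edge? i j)
      λ { (inj₁ (i<s , _)) → <⇒≱ i<s s≤i ; (inj₂ (j<s , _)) → <⇒≱ j<s (≤-trans s≤i (<⇒≤ i<j)) })) (∧-zeroʳ (i <ᵇ j))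

-- Assembling the bounds

m+n≤o⇒n≤o∸m : ∀ m {n o} → m + n ≤ o → n ≤ o ∸ m
m+n≤o⇒n≤o∸m m {n} le = m+n≤o⇒m≤o∸n n (≤-trans (≤-reflexive (+-comm n m)) le)

regular-witness : ∀ {a k n} → 2 ≤ a → a + 2 ≤ k → k ∸ a < n →
  Σ (Graph n) λ G → IsSimple G × Connected G × ¬ Contains G (broom k a) × edgeCount G ≡ ⌊ (k ∸ a) * n /2⌋
regular-witness {a} {k} {n} 2≤a a+2≤k d<n
  with nearly-regular (k ∸ a) n (m+n≤o⇒n≤o∸m a a+2≤k) d<n
... | G , simple , conn , deg≤ , edges = G , simple , conn , free , edges
  where
  free : ¬ Contains G (broom k a)
  free c with degree-broom G 2≤a (<-≤-trans (m<m+n a z<s) a+2≤k) c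
  ... | u , high = <⇒≱ high (deg≤ u)

-- The construction is connected for `0 < s < n`; in the remaining cases the product vanishes.
bipartite-bound : ∀ {a k n m} s → a < k → suc (s + s) ≤ a →
  (∀ (G : Graph n) → IsSimple G → Connected G → ¬ Contains G (broom k a) → edgeCount G ≤ m) → s * (n ∸ s) ≤ m
bipartite-bound zero _ _ _ = z≤n
bipartite-bound {n = n} {m} s@(suc _) a<k 2s<a maximal with s <? n
... | no s≮n = subst (_≤ m) (sym (trans (cong (s *_) (m≤n⇒m∸n≡0 (≮⇒≥ s≮n))) (*-zeroʳ s))) z≤n
... | yes s<n = subst (_≤ m) edges (maximal bipartite bipartite-simple (bipartite-connected z<s s<n) (bipartite-free a<k 2s<a))
  where
  open Bipartite n s
  edges : edgeCount bipartite ≡ s * (n ∸ s)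
  edges = subst (λ n′ → edgeCount (Bipartite.bipartite n′ s) ≡ s * (n ∸ s)) (m+[n∸m]≡n (<⇒≤ s<n)) (bipartite-edges s (n ∸ s))

theorem3p2 : (∀ (a k : ℕ) → 2 ≤ a → a ≤ k ∸ 2 → ∀ (n m : ℕ) → k < a + n → IsExc n (broom k a) m →
    (⌊ (k ∸ a) * n /2⌋ ⊔ (⌊ a ∸ 1 /2⌋ * (n ∸ ⌊ a ∸ 1 /2⌋))) ≤ m)
    × (∀ (a k : ℕ) → 2 ≤ a → 3 * a ≤ k →
    ∃ λ (N : ℕ) → ∀ (n : ℕ) → N ≤ n → IsExc n (broom k a) ⌊ (k ∸ a) * n /2⌋)
theorem3p2 = lower , exact
  where
  lower : ∀ (a k : ℕ) → 2 ≤ a → a ≤ k ∸ 2 → ∀ (n m : ℕ) → k < a + n → IsExc n (broom k a) m →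
    (⌊ (k ∸ a) * n /2⌋ ⊔ (⌊ a ∸ 1 /2⌋ * (n ∸ ⌊ a ∸ 1 /2⌋))) ≤ m
  lower a@(suc a-1) k 2≤a a≤k∸2 n m k<a+n (_ , maximal) = ⊔-lub regular
    (bipartite-bound ⌊ a-1 /2⌋ (<-≤-trans (m<m+n a z<s) a+2≤k) (s≤s (⌊n/2⌋+⌊n/2⌋≤n a-1)) maximal)
    where
    -- Were the subtraction truncated to 0, `a` would be 0; hence `a ≤ k ∸ 2` does give `a + 2 ≤ k`.
    2≤k : 2 ≤ k
    2≤k = <⇒≤ (m∸n≢0⇒n<m λ k∸2≡0 → n≮0 (≤-trans (≤-trans 2≤a a≤k∸2) (≤-reflexive k∸2≡0)))
    a+2≤k : a + 2 ≤ k
    a+2≤k = ≤-trans (+-monoˡ-≤ 2 a≤k∸2) (≤-reflexive (m∸n+n≡m 2≤k))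
    d<n : k ∸ a < n
    d<n = +-cancelˡ-< a _ _ (subst (_< a + n) (sym (m+[n∸m]≡n (≤-trans (m≤m+n a 2) a+2≤k))) k<a+n)
    regular : ⌊ (k ∸ a) * n /2⌋ ≤ m
    regular with regular-witness 2≤a a+2≤k d<n
    ... | G , simple , conn , free , edges = subst (_≤ m) edges (maximal G simple conn free)

  exact : ∀ (a k : ℕ) → 2 ≤ a → 3 * a ≤ k →
    ∃ λ (N : ℕ) → ∀ (n : ℕ) → N ≤ n → IsExc n (broom k a) ⌊ (k ∸ a) * n /2⌋
  exact (suc zero) _ (s≤s ()) _
  -- The first summand of the threshold yields a vertex far from any given one; the second gives
  -- `k ∸ a < n`, as the extremal graph requires.
  exact a@(suc (suc b)) k 2≤a 3a≤k = suc ((k ∸ 1) ^ b) + suc k , λ n N≤n →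
    regular-witness 2≤a a+2≤k (≤-trans (s≤s (m∸n≤m k a)) (m+n≤o⇒n≤o (suc ((k ∸ 1) ^ b)) N≤n)) ,
    λ G simple conn free → edges-≤ G simple conn b-small (m+n≤o⇒m≤o (suc ((k ∸ 1) ^ b)) N≤n) free
    where
    a+2a≤k : a + (a + a) ≤ k
    a+2a≤k = ≤-trans (≤-reflexive (cong (λ t → a + (a + t)) (sym (+-identityʳ a)))) 3a≤k
    a+2≤k : a + 2 ≤ k
    a+2≤k = ≤-trans (+-monoʳ-≤ a (≤-trans 2≤a (m≤m+n a a))) a+2a≤k
    -- From `3a ≤ k` follows `2(a − 1) ≤ 2a ≤ k − a`, the density that peeling needs.
    b-small : suc b + suc b ≤ k ∸ a
    b-small = ≤-trans (+-mono-≤ (n≤1+n (suc b)) (n≤1+n (suc b))) (m+n≤o⇒n≤o∸m a a+2a≤k)
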